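{- Let $L,R$ be positive integers and let $p=p_{ -L}\cdots p_{ -1}\,X\,p_1\cdots p_R$ be an injective pattern. Let $f:\{0,1\}^{L+R+1}\to\{0,1\}$ be the injective pattern-induced rule of $p$, i.e. $f(a_{ -L},\dots,a_0,\dots,a_R)=1-a_0$ if $a_i=p_i$ for all $i\in\{ -L,\dots,R\}\setminus\{0\}$, and $f(a_{ -L},\dots,a_R)=a_0$ otherwise. Then the global transformation $\tau:\{0,1\}^{\mathbb{Z}}\to\{0,1\}^{\mathbb{Z}}$, $\tau(c)_n=f(c_{n-L},\dots,c_{n+R})$, is injective.
   Context: Patterns are finite words over the alphabet $\{0,1,X\}$, where $X$ is a wildcard standing for either state $0$ or $1$. Two words $u=u_1\cdots u_\ell$ and $v=v_1\cdots v_\ell$ of the same length over $\{0,1,X\}$ are called equal if for every position $t$ either $u_t=v_t$ or at least one of $u_t,v_t$ is $X$; otherwise they are unequal (i.e. there is a position $t$ with $u_t,v_t\in\{0,1\}$ and $u_t\neq v_t$). For a word $w=w_{ -L}\cdots w_{ -1}Xw_1\cdots w_R$ with $w_i\in\{0,1\}$ for $i\neq 0$ and the wildcard $X$ in position $0$, its prefix substring of length $\ell$ is $w_{ -L}\cdots w_{ -L+\ell-1}$ and its suffix substring of length $\ell$ is $w_{R-\ell+1}\cdots w_R$ ($1\le \ell\le L+R$). Such a word is an injective pattern if: when $L\le R$, for every $\ell$ with $L+1\le \ell\le L+R$ (i.e. every prefix substring containing $X$) the prefix substring of length $\ell$ is unequal to the suffix substring of length $\ell$; and when $L>R$, for every $\ell$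 with $R+1\le\ell\le L+R$ (every suffix substring containing $X$) the suffix substring of length $\ell$ is unequal to the prefix substring of length $\ell$. (For example, for $L=1,R=3$ the injective patterns are $0X011$, $0X110$, $1X001$, $1X100$.) The injective pattern-induced rule flips the centre cell exactly when the neighbourhood matches the pattern (with the centre arbitrary) and leaves it unchanged otherwise. $\tau$ is injective if $c_1\ne c_2$ implies $\tau(c_1)\ne\tau(c_2)$. -}

module Defs where

open import Data.Bool using (Bool; not; if_then_else_)
import Data.Bool.Properties as Bool
open import Data.Fin using (Fin; zero; toℕ; _↑ʳ_)
import Data.Fin.Properties as Fin
open import Data.Integer using (ℤ; +_; _+_; _-_)
open import Data.List using (List; take; drop; length)
open import Data.List.Relation.Binary.Pointwise using (Pointwise)
open import Data.Nat as ℕ using (ℕ; suc; _≤_; _<_; _∸_)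
open import Data.Product using (_×_)
open import Data.Sum using (_⊎_)
open import Data.Vec using (Vec; _∷_; _++_; map; lookup; tabulate; toList)
open import Relation.Binary using (DecidableEquality)
open import Relation.Binary.PropositionalEquality using (_≡_; _≢_; refl; cong)
open import Relation.Nullary using (¬_; Dec; yes; no; does)
open import Relation.Nullary.Decidable using (map′; ¬?; _→-dec_)

-- The states 0 and 1 are false and true, so that 1 - a is not a.
data Symbol : Set where
  bit : Bool → Symbol
  X   : Symbol

bit-injective : ∀ {a b} → bit a ≡ bit b → a ≡ b
bit-injective refl = refl

_≟_ : DecidableEquality Symbol
bit a ≟ bit b = map′ (cong bit) bit-injective (a Bool.≟ b)
bit _ ≟ X     = no λ ()
X     ≟ bit _ = no λ ()
X     ≟ X     = yes refl

-- Equality up to wildcards; not transitive.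
_≈_ : Symbol → Symbol → Set
s ≈ t = s ≡ t ⊎ (s ≡ X ⊎ t ≡ X)

Equal Unequal : List Symbol → List Symbol → Set
Equal       = Pointwise _≈_
Unequal u v = ¬ Equal u v

prefix suffix : ℕ → List Symbol → List Symbol
prefix ℓ w = take ℓ w
suffix ℓ w = drop (length w ∸ ℓ) w

-- Words and neighbourhoods are indexed by Fin (L + suc R): the index k stands
-- for the position k - L in {-L, …, R}.
centre : ∀ L {R} → Fin (L ℕ.+ suc R)
centre L = L ↑ʳ zero

-- The word p₋L ⋯ p₋₁ X p₁ ⋯ p_R.
word : ∀ {L R} → Vec Bool L → Vec Bool R → Vec Symbol (L ℕ.+ suc R)
word left right = map bit left ++ X ∷ map bit right

InjectivePattern : ∀ {L R} → Vec Bool L → Vec Bool R → Set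
InjectivePattern {L} {R} left right =
    (L ≤ R → ∀ ℓ → L ℕ.+ 1 ≤ ℓ → ℓ ≤ L ℕ.+ R → Unequal (prefix ℓ w) (suffix ℓ w))
  × (R < L → ∀ ℓ → R ℕ.+ 1 ≤ ℓ → ℓ ≤ L ℕ.+ R → Unequal (suffix ℓ w) (prefix ℓ w))
  where w = toList (word left right)

LocalRule : ℕ → ℕ → Set
LocalRule L R = Vec Bool (L ℕ.+ suc R) → Bool

Matches : ∀ L {R} → Vec Symbol (L ℕ.+ suc R) → Vec Bool (L ℕ.+ suc R) → Set
Matches L p a = ∀ k → k ≢ centre L → bit (lookup a k) ≡ lookup p k

matches? : ∀ L {R} (p : Vec Symbol (L ℕ.+ suc R)) a → Dec (Matches L p a)
matches? L p a =
  Fin.all? λ k → ¬? (k Fin.≟ centre L) →-dec (bit (lookup a k) ≟ lookup p k)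

patternRule : ∀ {L R} → Vec Bool L → Vec Bool R → LocalRule L R
patternRule {L} left right a =
  if does (matches? L (word left right) a) then not a₀ else a₀
  where a₀ = lookup a (centre L)

Configuration : Set
Configuration = ℤ → Bool

globalMap : ∀ {L R} → LocalRule L R → Configuration → Configuration
globalMap {L} f c n = f (tabulate λ k → c (n - + L + + toℕ k))

{-# OPTIONS --safe #-}
-- Two occurrences of p at distance d with 1 ≤ d ≤ max(L, R) overlap, and make
-- the prefix and the suffix of p of length L + R + 1 - d equal, which injectivity
-- of the pattern forbids. So no occurrence has another one's centre in its
-- neighbourhood. As τ flips only the centres of occurrences, an occurrence in c
-- persists in τ c. Conversely, at an occurrence in τ c no surrounding cell was
-- flipped, because the occurrence causing the flip would persist in τ c, too close
-- to the given one. So c and τ c have the same occurrences, and τ c determines c.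
module Submission where

open import Data.Bool using (Bool; not; if_then_else_)
open import Data.Bool.Properties using (not-injective)
open import Data.Fin as Fin using (Fin; toℕ)
open import Data.Fin.Properties using (toℕ-↑ʳ; toℕ-injective; toℕ<n)
open import Data.Integer as ℤ using (ℤ; +_)
import Data.Integer.Properties as ℤ
open import Data.Integer.Tactic.RingSolver using (solve-∀)
open import Data.List using (List; []; _∷_; take; drop; length)
open import Data.List.Properties using (length-take; length-drop)
open import Data.List.Relation.Binary.Pointwise using ([]; _∷_; symmetric)
open import Data.Nat using (ℕ; zero; suc; _+_; _∸_; _≤_; _<_; _⊔_; s≤s)
open import Data.Nat.Properties
open import Data.Product using (proj₁; proj₂)
open import Data.Sum using (inj₁; inj₂)
open import Data.Vec as Vec using (Vec; []; _∷_; lookup; tabulate; toList)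
open import Data.Vec.Properties using (lookup∘tabulate; lookup-++ʳ; length-toList)
open import Function using (_∘_)
open import Function.Definitions using (Injective)
open import Relation.Binary using (tri<; tri≈; tri>)
open import Relation.Binary.PropositionalEquality
  using (_≡_; _≢_; _≗_; refl; sym; trans; cong; subst; subst₂; module ≡-Reasoning)
open import Relation.Nullary using (¬_; Dec; yes; no)
open import Relation.Nullary.Decidable using (map′; dec-true; dec-false)
open import Defs

≈-sym : ∀ {s t} → s ≈ t → t ≈ s
≈-sym (inj₁ s≡t)        = inj₁ (sym s≡t)
≈-sym (inj₂ (inj₁ s≡X)) = inj₂ (inj₂ s≡X)
≈-sym (inj₂ (inj₂ t≡X)) = inj₂ (inj₁ t≡X)

-- Transitivity fails only through a wildcard in the middle; here the middle symbol is a bit.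
≈-trans-bit : ∀ {s t b} → s ≈ bit b → t ≈ bit b → s ≈ t
≈-trans-bit (inj₁ refl)       t≈b = ≈-sym t≈b
≈-trans-bit (inj₂ (inj₁ s≡X)) _   = inj₂ (inj₁ s≡X)

infixr 5 _∷_

-- The bits `f` are given on all of `ℕ`, not only up to the length of the word, so that dropping
-- letters is a mere shift of `f`.
data Reads : List Symbol → (ℕ → Bool) → Set where
  []  : ∀ {f} → Reads [] f
  _∷_ : ∀ {s w f} → s ≈ bit (f 0) → Reads w (f ∘ suc) → Reads (s ∷ w) f

reads-lookup : ∀ {n} (w : Vec Symbol n) {f} →
  (∀ k → lookup w k ≈ bit (f (toℕ k))) → Reads (toList w) f
reads-lookup []      _ = []
reads-lookup (s ∷ w) h = h Fin.zero ∷ reads-lookup w (h ∘ Fin.suc)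

reads-take : ∀ ℓ {w f} → Reads w f → Reads (take ℓ w) f
reads-take zero    _        = []
reads-take (suc ℓ) []       = []
reads-take (suc ℓ) (s ∷ rs) = s ∷ reads-take ℓ rs

reads-drop : ∀ d {w f} → Reads w f → Reads (drop d w) (λ t → f (d + t))
reads-drop zero    rs       = rs
reads-drop (suc d) []       = []
reads-drop (suc d) (_ ∷ rs) = reads-drop d rs

reads⇒Equal : ∀ {u v f g} → f ≗ g → length u ≡ length v →
  Reads u f → Reads v g → Equal u v
reads⇒Equal f≗g eq []       []       = []
reads⇒Equal f≗g eq (r ∷ rs) (s ∷ ss) =
  ≈-trans-bit r (subst (λ b → _ ≈ bit b) (sym (f≗g 0)) s) ∷
  reads⇒Equal (f≗g ∘ suc) (suc-injective eq) rs ss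

-- With a second copy of `w` placed `d` cells to the right of the first, its prefix and the first
-- copy's suffix lie over the same cells, so both agree with the same bits.
reads-overlap : ∀ {w f g} d → d ≤ length w → (∀ t → g t ≡ f (d + t)) →
  Reads w f → Reads w g →
  Equal (prefix (length w ∸ d) w) (suffix (length w ∸ d) w)
reads-overlap {w} d d≤n shift rf rg =
  -- `suffix` drops `length w ∸ ℓ` letters; this is `d` because `d` does not exceed the length.
  subst (λ e → Equal (take ℓ w) (drop e w)) (sym (m∸[m∸n]≡n d≤n))
    (reads⇒Equal shift lengths (reads-take ℓ rg) (reads-drop d rf))
  where
  ℓ = length w ∸ d
  lengths : length (take ℓ w) ≡ length (drop d w)
  lengths = trans (length-take ℓ w)
    (trans (m≤n⇒m⊓n≡m (m∸n≤m (length w) d)) (sym (length-drop d w)))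

_at_offset_ : ℤ → ℕ → ℕ → ℤ
n at L offset k = n ℤ.- + L ℤ.+ + k

offset-shift : ∀ n L d t → (n ℤ.+ + d) at L offset t ≡ n at L offset (d + t)
offset-shift n L d t = identity n (+ L) (+ d) (+ t)
  where
  identity : ∀ n l d t → n ℤ.+ d ℤ.- l ℤ.+ t ≡ n ℤ.- l ℤ.+ (d ℤ.+ t)
  identity = solve-∀

-- Writing the left radius as `k + e` avoids truncated subtraction and leaves a ring identity.
offset-before : ∀ n k e → n at (k + e) offset k ℤ.+ + e ≡ n
offset-before n k e = identity n (+ k) (+ e)
  where
  identity : ∀ n k e → n ℤ.- (k ℤ.+ e) ℤ.+ k ℤ.+ e ≡ n
  identity = solve-∀

offset-after : ∀ n L e → n at L offset (L + e) ≡ n ℤ.+ + e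
offset-after n L e = identity n (+ L) (+ e)
  where
  identity : ∀ n l e → n ℤ.- l ℤ.+ (l ℤ.+ e) ≡ n ℤ.+ e
  identity = solve-∀

toℕ-centre : ∀ L {R} → toℕ (centre L {R}) ≡ L
toℕ-centre L = trans (toℕ-↑ʳ L Fin.zero) (+-identityʳ L)

lookup-word-centre : ∀ {L R} (left : Vec Bool L) (right : Vec Bool R) →
  lookup (word left right) (centre L) ≡ X
lookup-word-centre left right =
  lookup-++ʳ (Vec.map bit left) (X ∷ Vec.map bit right) Fin.zero

module PatternRule {L R} (left : Vec Bool L) (right : Vec Bool R) where

  private
    w = word left right
    N = L + suc R

  τ : Configuration → Configuration
  τ = globalMap (patternRule left right)

  neighbourhood : Configuration → ℤ → Vec Bool N
  neighbourhood c n = tabulate λ k → c (n at L offset toℕ k)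

  -- A record rather than a synonym, so that c and n can be inferred.
  record Occurs (c : Configuration) (n : ℤ) : Set where
    constructor occurs
    field
      matches : Matches L w (neighbourhood c n)

  open Occurs

  occurs? : ∀ c n → Dec (Occurs c n)
  occurs? c n = map′ occurs matches (matches? L w (neighbourhood c n))

  lookup-neighbourhood : ∀ c n k → lookup (neighbourhood c n) k ≡ c (n at L offset toℕ k)
  lookup-neighbourhood c n = lookup∘tabulate (λ k → c (n at L offset toℕ k))

  lookup-neighbourhood-centre : ∀ c n → lookup (neighbourhood c n) (centre L) ≡ c n
  lookup-neighbourhood-centre c n = trans (lookup-neighbourhood c n (centre L)) (cong c (begin
    n at L offset toℕ (centre L) ≡⟨ cong (n at L offset_) (toℕ-↑ʳ L Fin.zero) ⟩
    n at L offset (L + 0)        ≡⟨ offset-after n L 0 ⟩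
    n ℤ.+ + 0                    ≡⟨ ℤ.+-identityʳ n ⟩
    n                            ∎))
    where open ≡-Reasoning

  -- The centre is exempt, so a flip there does not destroy the occurrence.
  Occurs-transport : ∀ {c d n} →
    (∀ k → k ≢ centre L → c (n at L offset toℕ k) ≡ d (n at L offset toℕ k)) →
    Occurs c n → Occurs d n
  Occurs-transport {c} {d} {n} agree occ = occurs λ k k≢0 → begin
    bit (lookup (neighbourhood d n) k) ≡⟨ cong bit (lookup-neighbourhood d n k) ⟩
    bit (d (n at L offset toℕ k))      ≡⟨ cong bit (agree k k≢0) ⟨
    bit (c (n at L offset toℕ k))      ≡⟨ cong bit (lookup-neighbourhood c n k) ⟨
    bit (lookup (neighbourhood c n) k) ≡⟨ matches occ k k≢0 ⟩
    lookup w k                         ∎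
    where open ≡-Reasoning

  private
    -- The local rule with the answer of its test as a variable, so that `cong` can insert the
    -- answer of `occurs?`. Since `map′` keeps the Boolean of `matches?`, the two agree by
    -- computation.
    flipIf : Bool → Configuration → ℤ → Bool
    flipIf b c n = if b then not a₀ else a₀
      where a₀ = lookup (neighbourhood c n) (centre L)

  τ-occurs : ∀ {c n} → Occurs c n → τ c n ≡ not (c n)
  τ-occurs {c} {n} occ = trans
    (cong (λ b → flipIf b c n) (dec-true (occurs? c n) occ))
    (cong not (lookup-neighbourhood-centre c n))

  τ-¬occurs : ∀ {c n} → ¬ Occurs c n → τ c n ≡ c n
  τ-¬occurs {c} {n} ¬occ = trans
    (cong (λ b → flipIf b c n) (dec-false (occurs? c n) ¬occ))
    (lookup-neighbourhood-centre c n)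

  occurs⇒reads : ∀ {c n} → Occurs c n → Reads (toList w) (λ t → c (n at L offset t))
  occurs⇒reads {c} {n} occ = reads-lookup w symbol
    where
    symbol : ∀ k → lookup w k ≈ bit (c (n at L offset toℕ k))
    symbol k with k Fin.≟ centre L
    -- An occurrence says nothing about its centre cell, but the wildcard agrees with either state.
    ... | yes refl = inj₂ (inj₁ (lookup-word-centre left right))
    ... | no k≢0   = inj₁ (trans (sym (matches occ k k≢0)) (cong bit (lookup-neighbourhood c n k)))

  occurs-overlap : ∀ {c n} d → d ≤ N → Occurs c n → Occurs c (n ℤ.+ + d) →
    Equal (prefix (N ∸ d) (toList w)) (suffix (N ∸ d) (toList w))
  occurs-overlap {c} {n} d d≤N occ occ′ =
    subst (λ m → Equal (prefix (m ∸ d) (toList w)) (suffix (m ∸ d) (toList w)))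
      (length-toList w)
      (reads-overlap d (subst (d ≤_) (sym (length-toList w)) d≤N)
        (λ t → cong c (offset-shift n L d t))
        (occurs⇒reads occ) (occurs⇒reads occ′))

  module _ (inj : InjectivePattern left right) where

    private
      overlap≤L+R : ∀ {d} → 1 ≤ d → N ∸ d ≤ L + R
      overlap≤L+R {d} 1≤d =
        m≤n+o⇒m∸n≤o N d (subst (_≤ d + (L + R)) (sym (+-suc L R)) (+-monoˡ-≤ (L + R) 1≤d))

    -- As `d` goes from `R` down to 1, the overlap `N ∸ d` goes from `L + 1` up to `L + R`, the
    -- lengths excluded when `L ≤ R`. For `R < L` the same holds with `L` and `R` exchanged.
    occurs-separated : ∀ {c n} d → 1 ≤ d → d ≤ L ⊔ R → Occurs c n → ¬ Occurs c (n ℤ.+ + d)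
    occurs-separated d 1≤d d≤L⊔R occ occ′ with ≤-<-connex L R
    ... | inj₁ L≤R =
      proj₁ inj L≤R (N ∸ d)
        (m+n≤o⇒m≤o∸n (L + 1) (subst (_≤ N) (sym (+-assoc L 1 d)) (+-monoʳ-≤ L (s≤s d≤R))))
        (overlap≤L+R 1≤d)
        (occurs-overlap d (m≤n⇒m≤o+n L (m≤n⇒m≤1+n d≤R)) occ occ′)
      where
      d≤R : d ≤ R
      d≤R = subst (d ≤_) (m≤n⇒m⊔n≡n L≤R) d≤L⊔R
    ... | inj₂ R<L =
      proj₂ inj R<L (N ∸ d)
        (m+n≤o⇒m≤o∸n (R + 1) (subst₂ _≤_ (+-comm d (R + 1)) (cong (λ m → L + m) (+-comm R 1))
          (+-monoˡ-≤ (R + 1) d≤L)))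
        (overlap≤L+R 1≤d)
        (symmetric ≈-sym (occurs-overlap d (m≤n⇒m≤n+o (suc R) d≤L) occ occ′))
      where
      d≤L : d ≤ L
      d≤L = subst (d ≤_) (m≥n⇒m⊔n≡m (<⇒≤ R<L)) d≤L⊔R

    occurs-isolated : ∀ {c n} (k : Fin N) → k ≢ centre L →
      Occurs c n → ¬ Occurs c (n at L offset toℕ k)
    occurs-isolated {c} {n} k k≢0 occ occ′ with <-cmp (toℕ k) L
    ... | tri≈ _ k≡L _ = k≢0 (toℕ-injective (trans k≡L (sym (toℕ-centre L))))
    -- The cell lies to the left of `n`, so its occurrence is the first of the two, at distance at
    -- most `L`.
    ... | tri< k<L _ _ =
      occurs-separated (L ∸ toℕ k) (m<n⇒0<n∸m k<L)
        (m≤n⇒m≤n⊔o R (m∸n≤m L (toℕ k)))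
        occ′ (subst (Occurs c) (sym centre≡) occ)
      where
      centre≡ : n at L offset toℕ k ℤ.+ + (L ∸ toℕ k) ≡ n
      centre≡ = subst (λ l → n at l offset toℕ k ℤ.+ + (L ∸ toℕ k) ≡ n)
        (m+[n∸m]≡n (<⇒≤ k<L)) (offset-before n (toℕ k) (L ∸ toℕ k))
    -- The cell lies to the right of `n`, at distance at most `R`.
    ... | tri> _ _ L<k =
      occurs-separated (toℕ k ∸ L) (m<n⇒0<n∸m L<k)
        (m≤n⇒m≤o⊔n L (m≤n+o⇒m∸n≤o (toℕ k) L k≤L+R))
        occ (subst (Occurs c) centre≡ occ′)
      where
      k≤L+R : toℕ k ≤ L + R
      k≤L+R = ≤-pred (subst (toℕ k <_) (+-suc L R) (toℕ<n k))
      centre≡ : n at L offset toℕ k ≡ n ℤ.+ + (toℕ k ∸ L)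
      centre≡ = trans (cong (n at L offset_) (sym (m+[n∸m]≡n (<⇒≤ L<k))))
        (offset-after n L (toℕ k ∸ L))

    occurs⇒occurs-τ : ∀ {c n} → Occurs c n → Occurs (τ c) n
    occurs⇒occurs-τ occ = Occurs-transport
      (λ k k≢0 → sym (τ-¬occurs (occurs-isolated k k≢0 occ))) occ

    occurs-τ⇒occurs : ∀ {c n} → Occurs (τ c) n → Occurs c n
    occurs-τ⇒occurs {c} {n} occ = Occurs-transport
      -- Isolation is used in `τ c`, where an occurrence of `c` at the cell would have persisted.
      (λ k k≢0 → τ-¬occurs {c} (occurs-isolated k k≢0 occ ∘ occurs⇒occurs-τ)) occ

    occurs-resp-τ : ∀ {c d n} → τ c ≗ τ d → Occurs c n → Occurs d n
    occurs-resp-τ {n = n} τc≗τd occ = occurs-τ⇒occurs (Occurs-transport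
      (λ k _ → τc≗τd (n at L offset toℕ k)) (occurs⇒occurs-τ occ))

    τ-injective : Injective _≗_ _≗_ τ
    τ-injective {c} {d} τc≗τd n with occurs? c n
    -- Both configurations are flipped at `n`, and `not` cancels.
    ... | yes occ = not-injective (trans (sym (τ-occurs occ))
      (trans (τc≗τd n) (τ-occurs (occurs-resp-τ τc≗τd occ))))
    ... | no ¬occ = trans (sym (τ-¬occurs ¬occ))
      (trans (τc≗τd n) (τ-¬occurs (¬occ ∘ occurs-resp-τ (sym ∘ τc≗τd))))

theorem3p1 : ∀ (L R : ℕ) → 1 ≤ L → 1 ≤ R → (left : Vec Bool L) (right : Vec Bool R) →
    InjectivePattern left right →
    Injective _≗_ _≗_ (globalMap (patternRule left right))
theorem3p1 L R _ _ left right inj = PatternRule.τ-injective left right inj
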